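{- Let $T(n)$ denote the number of array updates performed by the improved algorithm when filling in its four dimensional array for input $n$, that is, the number of quadruples of integers $(l,k,N,s)$ with $$1\le l\le n-1,\quad 1\le k\le n-3,\quad 1\le N\le \min\left\{lk,\left\lfloor \frac{n^2+3}{2}-2n\right\rfloor\right\},\quad m'(N,l)\le s\le M'(N,k).$$ Then $T(n)=\Theta(n^6)$, i.e. there exist real constants $0<a\le b$ such that $a\,n^6\le T(n)\le b\,n^6$ for all sufficiently large positive integers $n$.
   Context: For positive integers $N,k$, let $q=\lfloor N/k\rfloor$ and $r=N\bmod k$. The nonnegative integer $M'(N,k)$ is given by: - if $k<q$, $M'(N,k)=0$; - if $k\ge q$ and $r\le q$ (including $r=0$), $M'(N,k)=q(k-q+1)-r$; - if $k\ge q$ and $r>q$, $M'(N,k)=q(k-q-1)+r$. For positive integers $N,l$, let $q=\lfloor N/l\rfloor$ and $r=N\bmod l$. The nonnegative integer $m'(N,l)$ is given by: - if $l>q$, $m'(N,l)=0$; - if $l\le q$ and $r=0$, $m'(N,l)=l(q-l+1)$; - if $l\le q$ and $r>0$, $m'(N,l)=l(q-l)+r$. Background (not needed to read the claim): the improved algorithm computes the number $L(n)$ of zero-free graphical degree sequences of length $n$ with largest part less than $n-1$. It fills in a four dimensional array by four nested loops over $l,k,N,s$ with exactly the ranges in the claim, performing one update of an array element (using four previously stored values) for each quadruple. The range for $s$ is empty if $m'(N,l)>M'(N,k)$. -}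

module Defs where

open import Data.Bool.Base using (if_then_else_)
open import Data.Integer.Base using (+_)
open import Data.List.Base using (List; concatMap; length; map; upTo)
open import Data.Nat.Base
open import Data.Nat.DivMod using (_/_; _%_)
open import Data.Product.Base using (_×_; _,_)
open import Data.Rational.Base as ℚ using (ℚ)

-- M′ and m′ are only meaningful for a positive second argument; the value at 0
-- is junk and is never reached by `quadruples`.  The truncated subtractions
-- agree with integer subtraction in the branches where they occur.  In the last
-- branch of M′, q ≤ k and q < r < k, so k - q - 1 is nonnegative.

M′ : (N k : ℕ) → ℕ
M′ N zero        = 0
M′ N k@(suc _)   =
  if k <ᵇ q then 0
  else if r ≤ᵇ q then q * (k ∸ q + 1) ∸ r
  else q * (k ∸ q ∸ 1) + r
  where
  q = N / k
  r = N % k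

m′ : (N l : ℕ) → ℕ
m′ N zero        = 0
m′ N l@(suc _)   =
  if q <ᵇ l then 0
  else if r ≡ᵇ 0 then l * (q ∸ l + 1)
  else l * (q ∸ l) + r
  where
  q = N / l
  r = N % l

-- The integers a, a + 1, …, b in order; empty when b < a.
range : (a b : ℕ) → List ℕ
range a b = map (λ i → a + i) (upTo (suc b ∸ a))

-- ⌊(n² + 3)/2 - 2n⌋ = ⌊(n² + 3)/2⌋ - 2n since 2n is an integer.  It is negative
-- only for n = 2, where truncation to 0 still leaves no N ≥ 1 below the bound.
maxN : ℕ → ℕ
maxN n = (n ^ 2 + 3) / 2 ∸ 2 * n

-- All the bounds are nonnegative, so integer quadruples are quadruples in ℕ.
-- Truncating n - 1 and n - 3 at 0 leaves the ranges for l and k empty exactly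
-- when they are empty over the integers.
quadruples : ℕ → List (ℕ × ℕ × ℕ × ℕ)
quadruples n =
  concatMap (λ l →
  concatMap (λ k →
  concatMap (λ N →
  map       (λ s → l , k , N , s)
    (range (m′ N l) (M′ N k)))
    (range 1 ((l * k) ⊓ maxN n)))
    (range 1 (n ∸ 3)))
    (range 1 (n ∸ 1))

T : ℕ → ℕ
T n = length (quadruples n)

fromℕ : ℕ → ℚ
fromℕ m = + m ℚ./ 1

{-# OPTIONS --safe #-}
-- Upper bound: M′(N,k) ≤ N and N ≤ maxN n ≤ n², so each of the at most n² pairs
-- (l,k) contributes at most n²(n² + 1) updates.
--
-- Lower bound: with m = ⌊n/16⌋, restrict to 8m < l, k ≤ 9m and 16m² < N ≤ 17m².
-- There N < l², so m′(N,l) = 0, while m ≤ ⌊N/k⌋ ≤ 3m gives M′(N,k) ≥ m².  This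
-- box contains m · m · m² triples, each admitting more than m² values of s.
module Submission where

open import Defs
open import Data.Nat.Base as ℕ using (ℕ; _^_)
open import Data.Product.Base using (_×_; ∃-syntax)
open import Data.Rational.Base using (ℚ; 0ℚ; _<_; _≤_; _*_)

open import Data.Bool.Base as Bool using (Bool; true; false; if_then_else_)
open import Data.Integer.Base as ℤ using (+_)
import Data.Integer.Properties as ℤ
open import Data.List.Base using (List; applyUpTo; concatMap; length; map; upTo)
open import Data.List.Properties using (length-++; length-map; length-upTo; map-upTo)
open import Data.Nat.Base using (zero; suc; _∸_; _⊓_; _<ᵇ_; _≤ᵇ_; z≤n; s≤s)
open import Data.Nat.DivMod
  using (_/_; _%_; m≡m%n+[m/n]*n; m*n/n≡m; m<n*o⇒m/o<n; m%n<n; m/n*n≤m; /-monoˡ-≤)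
open import Data.Nat.Properties
open import Data.Nat.Tactic.RingSolver using (solve-∀)
open import Data.Product.Base using (_,_)
import Data.Rational.Base as ℚ
import Data.Rational.Properties as ℚ
open import Data.Rational.Unnormalised.Base as ℚᵘ using (mkℚᵘ; *≤*)
import Data.Rational.Unnormalised.Properties as ℚᵘ
open import Data.Unit.Base using (tt)
open import Function.Base using (_∘_)
open import Relation.Binary.PropositionalEquality
  using (_≡_; refl; sym; trans; cong; subst)
open import Relation.Nullary.Decidable using (from-yes)

private
  variable
    A : Set

-- Lengths of concatenations over ranges

module _ (f : ℕ → List A) where

  -- Stated for arbitrary `g` because the tail of `applyUpTo g (suc n)` is `applyUpTo (g ∘ suc) n`,
  -- as the induction requires.
  length-concatMap-applyUpTo-≤ : ∀ g n X →
    (∀ i → i ℕ.< n → length (f (g i)) ℕ.≤ X) →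
    length (concatMap f (applyUpTo g n)) ℕ.≤ n ℕ.* X
  length-concatMap-applyUpTo-≤ g zero    X h = z≤n
  length-concatMap-applyUpTo-≤ g (suc n) X h
    rewrite length-++ (f (g 0)) {concatMap f (applyUpTo (g ∘ suc) n)} =
    +-mono-≤ (h 0 (s≤s z≤n))
      (length-concatMap-applyUpTo-≤ (g ∘ suc) n X (λ i i<n → h (suc i) (s≤s i<n)))

  -- Only a window of `d` indices starting at `c` is counted: the induction skips the first `c`
  -- blocks, adds up `d` of them and drops the rest. This allows lower bounds from a box inside the
  -- ranges.
  length-concatMap-applyUpTo-≥ : ∀ g n c d X → c ℕ.+ d ℕ.≤ n →
    (∀ i → c ℕ.≤ i → i ℕ.< c ℕ.+ d → X ℕ.≤ length (f (g i))) →
    d ℕ.* X ℕ.≤ length (concatMap f (applyUpTo g n))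
  length-concatMap-applyUpTo-≥ g n       zero    zero    X c+d≤n h = z≤n
  length-concatMap-applyUpTo-≥ g (suc n) zero    (suc d) X (s≤s d≤n) h
    rewrite length-++ (f (g 0)) {concatMap f (applyUpTo (g ∘ suc) n)} =
    +-mono-≤ (h 0 z≤n (s≤s z≤n))
      (length-concatMap-applyUpTo-≥ (g ∘ suc) n 0 d X d≤n
        (λ i _ i<d → h (suc i) z≤n (s≤s i<d)))
  length-concatMap-applyUpTo-≥ g (suc n) (suc c) d       X (s≤s c+d≤n) h
    rewrite length-++ (f (g 0)) {concatMap f (applyUpTo (g ∘ suc) n)} =
    ≤-trans
      (length-concatMap-applyUpTo-≥ (g ∘ suc) n c d X c+d≤n
        (λ i c≤i i<c+d → h (suc i) (s≤s c≤i) (s≤s i<c+d)))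
      (m≤n+m _ _)

  length-concatMap-range1-≤ : ∀ b X →
    (∀ i → i ℕ.≤ b → length (f i) ℕ.≤ X) →
    length (concatMap f (range 1 b)) ℕ.≤ b ℕ.* X
  length-concatMap-range1-≤ b X h rewrite map-upTo (1 ℕ.+_) b =
    length-concatMap-applyUpTo-≤ (1 ℕ.+_) b X (λ i i<b → h (suc i) i<b)

  length-concatMap-range1-≥ : ∀ b c d X → c ℕ.+ d ℕ.≤ b →
    (∀ i → c ℕ.< i → i ℕ.≤ c ℕ.+ d → X ℕ.≤ length (f i)) →
    d ℕ.* X ℕ.≤ length (concatMap f (range 1 b))
  length-concatMap-range1-≥ b c d X c+d≤b h rewrite map-upTo (1 ℕ.+_) b =
    length-concatMap-applyUpTo-≥ (1 ℕ.+_) b c d X c+d≤b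
      -- The element at index `i` is `suc i`, so the half-open window of indices becomes
      -- `c < i ≤ c + d` for elements.
      (λ i c≤i i<c+d → h (suc i) (s≤s c≤i) i<c+d)

length-map-range : ∀ (f : ℕ → A) a b → length (map f (range a b)) ≡ suc b ∸ a
length-map-range f a b =
  trans (length-map f (range a b))
    (trans (length-map (λ i → a ℕ.+ i) (upTo (suc b ∸ a))) (length-upTo (suc b ∸ a)))

-- Bounds on M′ and m′

-- Every branch is at most `r + q * k`, which is `N` by division with remainder.
M′≤N : ∀ N k → M′ N k ℕ.≤ N
M′≤N N zero       = z≤n
M′≤N N k@(suc k′) = ≤-trans (bound (N / k) (N % k) (k <ᵇ N / k) (N % k ≤ᵇ N / k))
                            (≤-reflexive (sym (m≡m%n+[m/n]*n N k)))
  where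
  k∸q+1≤k : ∀ q → k ∸ suc q ℕ.+ 1 ℕ.≤ k
  k∸q+1≤k q rewrite +-comm (k′ ∸ q) 1 = s≤s (m∸n≤m k′ q)

  q[k∸q+1]≤qk : ∀ q → q ℕ.* (k ∸ q ℕ.+ 1) ℕ.≤ q ℕ.* k
  -- Here the second factor is `k + 1`, which exceeds `k`; the inequality survives only because `q`
  -- is zero.
  q[k∸q+1]≤qk zero    = z≤n
  q[k∸q+1]≤qk (suc q) = *-monoʳ-≤ (suc q) (k∸q+1≤k q)

  bound : ∀ q r (b₁ b₂ : Bool) →
    (if b₁ then 0 else if b₂ then q ℕ.* (k ∸ q ℕ.+ 1) ∸ r else q ℕ.* (k ∸ q ∸ 1) ℕ.+ r)
    ℕ.≤ r ℕ.+ q ℕ.* k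
  bound q r true  _     = z≤n
  bound q r false true  =
    ≤-trans (m∸n≤m _ r) (≤-trans (q[k∸q+1]≤qk q) (m≤n+m _ r))
  bound q r false false = ≤-trans (≤-reflexive (+-comm _ r))
    (+-monoʳ-≤ r (*-monoʳ-≤ q (≤-trans (m∸n≤m (k ∸ q) 1) (m∸n≤m k q))))

-- A lower bound common to all three branches: for `k < q` truncation makes it zero, for `r ≤ q` the
-- subtracted `r` is paid for by one copy of `q`, and otherwise only `r` is dropped.
q[k∸q∸1]≤M′ : ∀ N k .{{_ : ℕ.NonZero k}} →
  N / k ℕ.* (k ∸ N / k ∸ 1) ℕ.≤ M′ N k
q[k∸q∸1]≤M′ N k@(suc _) = bound (N / k) (N % k)
  where
  bound : ∀ q r → q ℕ.* (k ∸ q ∸ 1) ℕ.≤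
    (if k <ᵇ q then 0
     else if r ≤ᵇ q then q ℕ.* (k ∸ q ℕ.+ 1) ∸ r
     else q ℕ.* (k ∸ q ∸ 1) ℕ.+ r)
  bound q r with k <ᵇ q in k<q
  ... | true
      rewrite m≤n⇒m∸n≡0 (<⇒≤ (<ᵇ⇒< k q (subst Bool.T (sym k<q) tt))) =
        ≤-reflexive (*-zeroʳ q)
  ... | false with r ≤ᵇ q in r≤q
  ...   | false = m≤m+n _ r
  ...   | true  = m+n≤o⇒m≤o∸n _ (begin
    q ℕ.* (k ∸ q ∸ 1) ℕ.+ r  ≤⟨ +-mono-≤ (*-monoʳ-≤ q (m∸n≤m (k ∸ q) 1))
                                  (≤ᵇ⇒≤ r q (subst Bool.T (sym r≤q) tt)) ⟩
    q ℕ.* (k ∸ q) ℕ.+ q      ≡⟨ distrib q (k ∸ q) ⟩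
    q ℕ.* (k ∸ q ℕ.+ 1)      ∎)
    where
    open ≤-Reasoning
    distrib : ∀ x y → x ℕ.* y ℕ.+ x ≡ x ℕ.* (y ℕ.+ 1)
    distrib = solve-∀

-- From `N < l * l` the quotient `N / l` is below `l`, which selects the zero branch.
m′≡0 : ∀ N l → N ℕ.< l ℕ.* l → m′ N l ≡ 0
m′≡0 N l@(suc _) N<l² with N / l <ᵇ l | <⇒<ᵇ (m<n*o⇒m/o<n {N} {l} {l} N<l²)
... | true | _ = refl

-- With `q = N / k`, both factors of `q * (k ∸ q ∸ 1)` are at least `m`: the first since 9 ≤ 16, the
-- second since `q ≤ 3m` while `k > 8m`.
m²≤M′ : ∀ m N k → 8 ℕ.* m ℕ.< k → k ℕ.≤ 9 ℕ.* m →
  16 ℕ.* (m ℕ.* m) ℕ.≤ N → N ℕ.≤ 17 ℕ.* (m ℕ.* m) → m ℕ.* m ℕ.≤ M′ N k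
m²≤M′ m N k@(suc _) 8m<k k≤9m 16m²≤N N≤17m² =
  ≤-trans (*-mono-≤ m≤q m≤k∸q∸1) (q[k∸q∸1]≤M′ N k)
  where
  open ≤-Reasoning

  m≤q : m ℕ.≤ N / k
  m≤q = begin
    m            ≡⟨ m*n/n≡m m k ⟨
    m ℕ.* k / k  ≤⟨ /-monoˡ-≤ k (begin
      m ℕ.* k           ≤⟨ *-monoʳ-≤ m k≤9m ⟩
      m ℕ.* (9 ℕ.* m)   ≡⟨ eq m ⟩
      9 ℕ.* (m ℕ.* m)   ≤⟨ *-monoˡ-≤ (m ℕ.* m) (from-yes (9 ≤? 16)) ⟩
      16 ℕ.* (m ℕ.* m)  ≤⟨ 16m²≤N ⟩
      N                 ∎) ⟩
    N / k        ∎
    where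
    eq : ∀ m → m ℕ.* (9 ℕ.* m) ≡ 9 ℕ.* (m ℕ.* m)
    eq = solve-∀

  q≤3m : N / k ℕ.≤ 3 ℕ.* m
  -- It suffices that `N < (3m + 1) * k`; as `k > 8m`, already `3m * k` is at least `24m²`, and the
  -- extra `k` gives strictness.
  q≤3m = ≤-pred (m<n*o⇒m/o<n (begin-strict
    N                          ≤⟨ N≤17m² ⟩
    17 ℕ.* (m ℕ.* m)           ≤⟨ *-monoˡ-≤ (m ℕ.* m) (from-yes (17 ≤? 24)) ⟩
    24 ℕ.* (m ℕ.* m)           ≡⟨ eq m ⟩
    (3 ℕ.* m) ℕ.* (8 ℕ.* m)    ≤⟨ *-monoʳ-≤ (3 ℕ.* m) (<⇒≤ 8m<k) ⟩
    (3 ℕ.* m) ℕ.* k            <⟨ m<n+m _ (s≤s z≤n) ⟩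
    k ℕ.+ (3 ℕ.* m) ℕ.* k      ∎))
    where
    eq : ∀ m → 24 ℕ.* (m ℕ.* m) ≡ (3 ℕ.* m) ℕ.* (8 ℕ.* m)
    eq = solve-∀

  m≤k∸q∸1 : m ℕ.≤ k ∸ N / k ∸ 1
  -- The strict inequality `8m < k` pays for the final `∸ 1`.
  m≤k∸q∸1 = m+n≤o⇒m≤o∸n m (m+n≤o⇒m≤o∸n (m ℕ.+ 1) (begin
    m ℕ.+ 1 ℕ.+ N / k        ≤⟨ +-monoʳ-≤ (m ℕ.+ 1) q≤3m ⟩
    m ℕ.+ 1 ℕ.+ 3 ℕ.* m      ≡⟨ eq m ⟩
    suc (4 ℕ.* m)            ≤⟨ s≤s (*-monoˡ-≤ m (from-yes (4 ≤? 8))) ⟩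
    suc (8 ℕ.* m)            ≤⟨ 8m<k ⟩
    k                        ∎))
    where
    eq : ∀ m → m ℕ.+ 1 ℕ.+ 3 ℕ.* m ≡ suc (4 ℕ.* m)
    eq = solve-∀

-- Bounds on maxN

maxN≤n² : ∀ n → 1 ℕ.≤ n → maxN n ℕ.≤ n ℕ.* n
maxN≤n² n 1≤n = m≤n+o⇒m∸n≤o _ (2 ℕ.* n) (begin
  (n ^ 2 ℕ.+ 3) / 2                         ≤⟨ /-monoˡ-≤ 2 (begin
    -- The 3 is absorbed by `3n`, and the slack `n² + n` completes the sum to an exact double, so
    -- that halving loses nothing.
    n ^ 2 ℕ.+ 3                             ≤⟨ +-monoʳ-≤ (n ^ 2) (*-monoʳ-≤ 3 1≤n) ⟩
    n ^ 2 ℕ.+ 3 ℕ.* n                       ≤⟨ m≤m+n _ _ ⟩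
    n ^ 2 ℕ.+ 3 ℕ.* n ℕ.+ (n ℕ.* n ℕ.+ n)   ≡⟨ eq n ⟩
    (2 ℕ.* n ℕ.+ n ℕ.* n) ℕ.* 2             ∎) ⟩
  (2 ℕ.* n ℕ.+ n ℕ.* n) ℕ.* 2 / 2           ≡⟨ m*n/n≡m (2 ℕ.* n ℕ.+ n ℕ.* n) 2 ⟩
  2 ℕ.* n ℕ.+ n ℕ.* n                       ∎)
  where
  open ≤-Reasoning
  eq : ∀ n → n ℕ.* (n ℕ.* 1) ℕ.+ 3 ℕ.* n ℕ.+ (n ℕ.* n ℕ.+ n) ≡ (2 ℕ.* n ℕ.+ n ℕ.* n) ℕ.* 2
  eq = solve-∀

-- After doubling, the claim is `34m² + 4n ≤ n²`. Since `n² ≥ 16mn = 12mn + 4mn`, the first summand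
-- is at least `192m²` and the second at least `4n`.
17m²≤maxN : ∀ m n → 1 ℕ.≤ m → 16 ℕ.* m ℕ.≤ n → 17 ℕ.* (m ℕ.* m) ℕ.≤ maxN n
17m²≤maxN m n 1≤m 16m≤n = m+n≤o⇒m≤o∸n (17 ℕ.* (m ℕ.* m)) (begin
  x                ≡⟨ m*n/n≡m x 2 ⟨
  x ℕ.* 2 / 2      ≤⟨ /-monoˡ-≤ 2 (begin
    x ℕ.* 2                                          ≡⟨ eq₁ m n ⟩
    34 ℕ.* (m ℕ.* m) ℕ.+ 4 ℕ.* 1 ℕ.* n
      ≤⟨ +-mono-≤ (*-monoˡ-≤ (m ℕ.* m) (from-yes (34 ≤? 192)))
                  (*-monoˡ-≤ n (*-monoʳ-≤ 4 1≤m)) ⟩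
    192 ℕ.* (m ℕ.* m) ℕ.+ 4 ℕ.* m ℕ.* n              ≡⟨ eq₂ m n ⟩
    12 ℕ.* m ℕ.* (16 ℕ.* m) ℕ.+ 4 ℕ.* m ℕ.* n
      ≤⟨ +-monoˡ-≤ (4 ℕ.* m ℕ.* n) (*-monoʳ-≤ (12 ℕ.* m) 16m≤n) ⟩
    12 ℕ.* m ℕ.* n ℕ.+ 4 ℕ.* m ℕ.* n                 ≡⟨ eq₃ m n ⟩
    16 ℕ.* m ℕ.* n                                   ≤⟨ *-monoˡ-≤ n 16m≤n ⟩
    n ℕ.* n                                          ≡⟨ eq₄ n ⟩
    n ^ 2                                            ≤⟨ m≤m+n _ 3 ⟩
    n ^ 2 ℕ.+ 3                                      ∎) ⟩
  (n ^ 2 ℕ.+ 3) / 2  ∎)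
  where
  open ≤-Reasoning
  x = 17 ℕ.* (m ℕ.* m) ℕ.+ 2 ℕ.* n
  eq₁ : ∀ m n → (17 ℕ.* (m ℕ.* m) ℕ.+ 2 ℕ.* n) ℕ.* 2 ≡ 34 ℕ.* (m ℕ.* m) ℕ.+ 4 ℕ.* 1 ℕ.* n
  eq₁ = solve-∀
  eq₂ : ∀ m n → 192 ℕ.* (m ℕ.* m) ℕ.+ 4 ℕ.* m ℕ.* n ≡ 12 ℕ.* m ℕ.* (16 ℕ.* m) ℕ.+ 4 ℕ.* m ℕ.* n
  eq₂ = solve-∀
  eq₃ : ∀ m n → 12 ℕ.* m ℕ.* n ℕ.+ 4 ℕ.* m ℕ.* n ≡ 16 ℕ.* m ℕ.* n
  eq₃ = solve-∀
  eq₄ : ∀ n → n ℕ.* n ≡ n ℕ.* (n ℕ.* 1)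
  eq₄ = solve-∀

-- Bounds on T

T≤2n⁶ : ∀ n → 1 ℕ.≤ n → T n ℕ.≤ 2 ℕ.* n ^ 6
T≤2n⁶ n 1≤n = begin
  T n
    ≤⟨ length-concatMap-range1-≤ _ (n ∸ 1) (n ℕ.* (n² ℕ.* (2 ℕ.* n²))) (λ l _ →
       ≤-trans
         (length-concatMap-range1-≤ _ (n ∸ 3) (n² ℕ.* (2 ℕ.* n²)) (λ k _ →
          ≤-trans
            (length-concatMap-range1-≤ _ (l ℕ.* k ⊓ maxN n) (2 ℕ.* n²) (λ N N≤ →
               inner l k N (≤-trans N≤ (≤-trans (m⊓n≤n (l ℕ.* k) _) (maxN≤n² n 1≤n)))))
            (*-monoˡ-≤ _ (≤-trans (m⊓n≤n (l ℕ.* k) _) (maxN≤n² n 1≤n)))))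
         (*-monoˡ-≤ _ (m∸n≤m n 3))) ⟩
  (n ∸ 1) ℕ.* (n ℕ.* (n² ℕ.* (2 ℕ.* n²)))
    ≤⟨ *-monoˡ-≤ _ (m∸n≤m n 1) ⟩
  n ℕ.* (n ℕ.* (n² ℕ.* (2 ℕ.* n²)))
    ≡⟨ eq n ⟩
  2 ℕ.* n ^ 6 ∎
  where
  open ≤-Reasoning
  n² = n ℕ.* n
  inner : ∀ l k N → N ℕ.≤ n² →
    length (map (λ s → l , k , N , s) (range (m′ N l) (M′ N k))) ℕ.≤ 2 ℕ.* n²
  inner l k N N≤n² = begin
    length (map (λ s → l , k , N , s) (range (m′ N l) (M′ N k)))
                            ≡⟨ length-map-range (λ s → l , k , N , s) (m′ N l) (M′ N k) ⟩
    suc (M′ N k) ∸ m′ N l   ≤⟨ m∸n≤m _ (m′ N l) ⟩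
    suc (M′ N k)            ≤⟨ s≤s (≤-trans (M′≤N N k) N≤n²) ⟩
    -- The extra 1 comes from counting both ends of the range of `s`; absorbing it into `n²`
    -- produces the constant 2.
    1 ℕ.+ n²                ≤⟨ +-monoˡ-≤ n² (*-mono-≤ 1≤n 1≤n) ⟩
    n² ℕ.+ n²               ≡⟨ cong (n² ℕ.+_) (+-identityʳ n²) ⟨
    2 ℕ.* n²                ∎
  eq : ∀ n → n ℕ.* (n ℕ.* (n ℕ.* n ℕ.* (2 ℕ.* (n ℕ.* n))))
           ≡ 2 ℕ.* (n ℕ.* (n ℕ.* (n ℕ.* (n ℕ.* (n ℕ.* (n ℕ.* 1))))))
  eq = solve-∀

-- Serves twice: to get `N < l * l`, and to keep the window for `N` below `l * k`.
17m²≤64m² : ∀ m → 17 ℕ.* (m ℕ.* m) ℕ.≤ (8 ℕ.* m) ℕ.* (8 ℕ.* m)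
17m²≤64m² m = ≤-trans (*-monoˡ-≤ (m ℕ.* m) (from-yes (17 ≤? 64))) (≤-reflexive (eq m))
  where
  eq : ∀ m → 64 ℕ.* (m ℕ.* m) ≡ (8 ℕ.* m) ℕ.* (8 ℕ.* m)
  eq = solve-∀

-- The lower end `m′ N l` vanishes, so `s` takes all values from 0 to `M′ N k`.
length-updates-≥ : ∀ m l k N → 8 ℕ.* m ℕ.< l → 8 ℕ.* m ℕ.< k → k ℕ.≤ 9 ℕ.* m →
  16 ℕ.* (m ℕ.* m) ℕ.≤ N → N ℕ.≤ 17 ℕ.* (m ℕ.* m) →
  m ℕ.* m ℕ.≤ length (map (λ s → l , k , N , s) (range (m′ N l) (M′ N k)))
length-updates-≥ m l k N 8m<l 8m<k k≤9m 16m²≤N N≤17m² = begin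
  m ℕ.* m                 ≤⟨ m²≤M′ m N k 8m<k k≤9m 16m²≤N N≤17m² ⟩
  M′ N k                  ≤⟨ n≤1+n _ ⟩
  suc (M′ N k)            ≡⟨ cong (suc (M′ N k) ∸_) (m′≡0 N l N<l²) ⟨
  suc (M′ N k) ∸ m′ N l   ≡⟨ length-map-range (λ s → l , k , N , s) (m′ N l) (M′ N k) ⟨
  length (map (λ s → l , k , N , s) (range (m′ N l) (M′ N k))) ∎
  where
  open ≤-Reasoning
  N<l² : N ℕ.< l ℕ.* l
  N<l² = ≤-<-trans (≤-trans N≤17m² (17m²≤64m² m)) (*-mono-< 8m<l 8m<l)

m⁶≤T : ∀ m n → 1 ℕ.≤ m → 16 ℕ.* m ℕ.≤ n → m ^ 6 ℕ.≤ T n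
m⁶≤T m n 1≤m 16m≤n = begin
  m ^ 6
    ≡⟨ eq m ⟩
  m ℕ.* (m ℕ.* (m² ℕ.* m²))
    ≤⟨ length-concatMap-range1-≥ _ (n ∸ 1) (8 ℕ.* m) m (m ℕ.* (m² ℕ.* m²)) 9m≤n∸1 (λ l 8m<l _ →
       length-concatMap-range1-≥ _ (n ∸ 3) (8 ℕ.* m) m (m² ℕ.* m²) 9m≤n∸3 (λ k 8m<k k≤9m →
       length-concatMap-range1-≥ _ (l ℕ.* k ⊓ maxN n) (16 ℕ.* m²) m² m²
         -- The window for `N` ends at `17m²`, which must lie below both members of the minimum.
         (⊓-glb (16m²+m²≤lk l k 8m<l 8m<k) (≤-trans 16m²+m²≤17m² (17m²≤maxN m n 1≤m 16m≤n)))
         (λ N 16m²<N N≤ →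
          length-updates-≥ m l k N 8m<l 8m<k (≤-trans k≤9m (≤-reflexive (+-comm (8 ℕ.* m) m)))
            (<⇒≤ 16m²<N) (≤-trans N≤ 16m²+m²≤17m²)))) ⟩
  T n ∎
  where
  open ≤-Reasoning
  m² = m ℕ.* m

  eq : ∀ m → m ℕ.* (m ℕ.* (m ℕ.* (m ℕ.* (m ℕ.* (m ℕ.* 1)))))
           ≡ m ℕ.* (m ℕ.* (m ℕ.* m ℕ.* (m ℕ.* m)))
  eq = solve-∀

  9m+3≤n : 8 ℕ.* m ℕ.+ m ℕ.+ 3 ℕ.≤ n
  9m+3≤n = begin
    -- Writing 3 as `3 * 1` lets `1 ≤ m` absorb the offset of `n ∸ 3`.
    8 ℕ.* m ℕ.+ m ℕ.+ 3 ℕ.* 1        ≤⟨ +-monoʳ-≤ (8 ℕ.* m ℕ.+ m) (*-monoʳ-≤ 3 1≤m) ⟩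
    8 ℕ.* m ℕ.+ m ℕ.+ 3 ℕ.* m        ≡⟨ 12m m ⟩
    12 ℕ.* m                         ≤⟨ *-monoˡ-≤ m (from-yes (12 ≤? 16)) ⟩
    16 ℕ.* m                         ≤⟨ 16m≤n ⟩
    n                                ∎
    where
    12m : ∀ m → 8 ℕ.* m ℕ.+ m ℕ.+ 3 ℕ.* m ≡ 12 ℕ.* m
    12m = solve-∀

  9m≤n∸3 : 8 ℕ.* m ℕ.+ m ℕ.≤ n ∸ 3
  9m≤n∸3 = m+n≤o⇒m≤o∸n _ 9m+3≤n

  9m≤n∸1 : 8 ℕ.* m ℕ.+ m ℕ.≤ n ∸ 1
  9m≤n∸1 = ≤-trans 9m≤n∸3 (∸-monoʳ-≤ n (s≤s z≤n))

  16m²+m²≤17m² : 16 ℕ.* m² ℕ.+ m² ℕ.≤ 17 ℕ.* m²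
  16m²+m²≤17m² = ≤-reflexive (+-comm (16 ℕ.* m²) m²)

  16m²+m²≤lk : ∀ l k → 8 ℕ.* m ℕ.< l → 8 ℕ.* m ℕ.< k → 16 ℕ.* m² ℕ.+ m² ℕ.≤ l ℕ.* k
  16m²+m²≤lk l k 8m<l 8m<k =
    ≤-trans 16m²+m²≤17m² (≤-trans (17m²≤64m² m) (*-mono-≤ (<⇒≤ 8m<l) (<⇒≤ 8m<k)))

^-distribʳ-* : ∀ o m n → (m ℕ.* n) ^ o ≡ m ^ o ℕ.* n ^ o
^-distribʳ-* zero    m n = refl
^-distribʳ-* (suc o) m n =
  trans (cong (m ℕ.* n ℕ.*_) (^-distribʳ-* o m n))
        ([m*n]*[o*p]≡[m*o]*[n*p] m n (m ^ o) (n ^ o))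

-- For `m = n / 16` one has `n < 16m + 16`, and `m ≥ 1` turns this into `n ≤ 32m`; sixth powers then
-- give the constant.
n⁶≤32⁶T : ∀ n → 16 ℕ.≤ n → n ^ 6 ℕ.≤ 32 ^ 6 ℕ.* T n
n⁶≤32⁶T n 16≤n = begin
  n ^ 6                ≤⟨ ^-monoˡ-≤ 6 n≤32m ⟩
  (32 ℕ.* m) ^ 6       ≡⟨ ^-distribʳ-* 6 32 m ⟩
  32 ^ 6 ℕ.* m ^ 6     ≤⟨ *-monoʳ-≤ (32 ^ 6) (m⁶≤T m n 1≤m 16m≤n) ⟩
  32 ^ 6 ℕ.* T n       ∎
  where
  open ≤-Reasoning
  m = n / 16

  1≤m : 1 ℕ.≤ m
  1≤m = /-monoˡ-≤ 16 16≤n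

  16m≤n : 16 ℕ.* m ℕ.≤ n
  16m≤n = ≤-trans (≤-reflexive (*-comm 16 m)) (m/n*n≤m n 16)

  n≤32m : n ℕ.≤ 32 ℕ.* m
  n≤32m = begin
    n                          ≡⟨ m≡m%n+[m/n]*n n 16 ⟩
    n % 16 ℕ.+ m ℕ.* 16        ≤⟨ +-monoˡ-≤ (m ℕ.* 16) (<⇒≤ (m%n<n n 16)) ⟩
    16 ℕ.* 1 ℕ.+ m ℕ.* 16      ≤⟨ +-monoˡ-≤ (m ℕ.* 16) (*-monoʳ-≤ 16 1≤m) ⟩
    16 ℕ.* m ℕ.+ m ℕ.* 16      ≡⟨ eq m ⟩
    32 ℕ.* m                   ∎
    where
    eq : ∀ m → 16 ℕ.* m ℕ.+ m ℕ.* 16 ≡ 32 ℕ.* m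
    eq = solve-∀

-- Transfer to ℚ

-- `fromℕ` normalises its fraction and does not compute on a variable, so the comparison is made on
-- unnormalised fractions with denominator 1.
fromℕ-mono-≤ : ∀ {m n} → m ℕ.≤ n → fromℕ m ≤ fromℕ n
fromℕ-mono-≤ {m} {n} m≤n = ℚ.toℚᵘ-cancel-≤ (begin
  ℚ.toℚᵘ (fromℕ m)  ≃⟨ ℚ.toℚᵘ-fromℚᵘ (mkℚᵘ (+ m) 0) ⟩
  mkℚᵘ (+ m) 0      ≤⟨ *≤* (ℤ.*-monoʳ-≤-nonNeg (+ 1) (ℤ.+≤+ m≤n)) ⟩
  mkℚᵘ (+ n) 0      ≃⟨ ℚ.toℚᵘ-fromℚᵘ (mkℚᵘ (+ n) 0) ⟨
  ℚ.toℚᵘ (fromℕ n)  ∎)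
  where open ℚᵘ.≤-Reasoning

fromℕ-homo-* : ∀ m n → fromℕ (m ℕ.* n) ≡ fromℕ m * fromℕ n
fromℕ-homo-* m n = ℚ.toℚᵘ-injective (begin-equality
  ℚ.toℚᵘ (fromℕ (m ℕ.* n))               ≃⟨ ℚ.toℚᵘ-fromℚᵘ (mkℚᵘ (+ (m ℕ.* n)) 0) ⟩
  mkℚᵘ (+ (m ℕ.* n)) 0                   ≡⟨ cong (λ i → mkℚᵘ i 0) (ℤ.pos-* m n) ⟩
  mkℚᵘ (+ m) 0 ℚᵘ.* mkℚᵘ (+ n) 0         ≃⟨ ℚᵘ.*-cong (ℚ.toℚᵘ-fromℚᵘ (mkℚᵘ (+ m) 0))
                                                      (ℚ.toℚᵘ-fromℚᵘ (mkℚᵘ (+ n) 0)) ⟨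
  ℚ.toℚᵘ (fromℕ m) ℚᵘ.* ℚ.toℚᵘ (fromℕ n) ≃⟨ ℚ.toℚᵘ-homo-* (fromℕ m) (fromℕ n) ⟨
  ℚ.toℚᵘ (fromℕ m * fromℕ n)             ∎)
  where open ℚᵘ.≤-Reasoning

mainTheorem2 : ∃[ a ] ∃[ b ] (0ℚ < a × a ≤ b ×
    ∃[ n₀ ] ((n : ℕ) → n₀ ℕ.≤ n →
    a * fromℕ (n ^ 6) ≤ fromℕ (T n) × fromℕ (T n) ≤ b * fromℕ (n ^ 6)))
mainTheorem2 =
  -- Rational constants are in particular real. The threshold 16 makes `n / 16` positive.
  a , fromℕ 2 , from-yes (0ℚ ℚ.<? a) , from-yes (a ℚ.≤? fromℕ 2) , 16 , λ n 16≤n →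
    lower n 16≤n , upper n (≤-trans (s≤s z≤n) 16≤n)
  where
  open ℚ.≤-Reasoning

  a : ℚ
  a = ℚ.1/ fromℕ (32 ^ 6)

  lower : ∀ n → 16 ℕ.≤ n → a * fromℕ (n ^ 6) ≤ fromℕ (T n)
  lower n 16≤n = begin
    a * fromℕ (n ^ 6)                   ≤⟨ ℚ.*-monoˡ-≤-nonNeg a (fromℕ-mono-≤ (n⁶≤32⁶T n 16≤n)) ⟩
    a * fromℕ (32 ^ 6 ℕ.* T n)          ≡⟨ cong (a *_) (fromℕ-homo-* (32 ^ 6) (T n)) ⟩
    a * (fromℕ (32 ^ 6) * fromℕ (T n))  ≡⟨ ℚ.*-assoc a (fromℕ (32 ^ 6)) (fromℕ (T n)) ⟨
    a * fromℕ (32 ^ 6) * fromℕ (T n)    ≡⟨ cong (_* fromℕ (T n)) (ℚ.*-inverseˡ (fromℕ (32 ^ 6))) ⟩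
    ℚ.1ℚ * fromℕ (T n)                  ≡⟨ ℚ.*-identityˡ (fromℕ (T n)) ⟩
    fromℕ (T n)                         ∎

  upper : ∀ n → 1 ℕ.≤ n → fromℕ (T n) ≤ fromℕ 2 * fromℕ (n ^ 6)
  upper n 1≤n = begin
    fromℕ (T n)              ≤⟨ fromℕ-mono-≤ (T≤2n⁶ n 1≤n) ⟩
    fromℕ (2 ℕ.* n ^ 6)      ≡⟨ fromℕ-homo-* 2 (n ^ 6) ⟩
    fromℕ 2 * fromℕ (n ^ 6)  ∎
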